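{- For every integer $n\ge 1$, $|\mathcal{S}_n(23;\,2\to 1)| = B_n$, where $B_n$ is the $n$-th Bell number.
   Context: $[n]=\{1,\dots,n\}$, and $\mathcal{S}_n$ is the set of permutations $\pi=\pi_1\pi_2\cdots\pi_n$ of $[n]$ in one-line notation. The permutation $\hat\pi$: for $\pi\in\mathcal{S}_n$, $\hat\pi\in\mathcal{S}_n$ is the permutation whose cycle form is obtained from the word $\pi_1\cdots\pi_n$ by inserting a left parenthesis before each left-to-right maximum (an entry larger than all entries to its left) and a right parenthesis immediately before the next left-to-right maximum, or at the end of the word. A cycle $(c_1,c_2,\dots,c_s)$ means $c_1\mapsto c_2\mapsto\cdots\mapsto c_s\mapsto c_1$. Example: if $\pi=2537164$ then $\hat\pi=(2)(53)(7164)$. Arrow patterns: an arrow pattern of size $k$ is a pair $(\nu;H)$ where $\nu=\nu_1\cdots\nu_m$ is a word of distinct positive integers, $H$ is a collection of arrows $b_i\to c_i$, and the set of all integers appearing in $\nu$ or $H$ is $[k]$. A permutation $\pi\in\mathcal{S}_n$ contains $(\nu;H)$ if there are a set $X=\{x_1<x_2<\cdots<x_k\}\subseteq[n]$ and indices $t_1<\cdots<t_m$ such that $\pi_{t_1}\pi_{t_2}\cdots\pi_{t_m}=x_{\nu_1}x_{\nu_2}\cdots x_{\nu_m}$ and $\hat\pi(x_{b_i})=x_{c_i}$ for every arrow $b_i\to c_i$ in $H$. Otherwise $\pi$ avoids $(\nu;H)$. $\mathcal{S}_n(\nu;H)$ is the set of permutations in $\mathcal{S}_n$ avoiding $(\nu;H)$.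 The Bell number $B_n$ is the number of set partitions of $[n]$. -}

module Defs where

open import Data.Fin using (Fin; _<_)
open import Data.Fin.Patterns using (0F; 1F; 2F; 3F; 4F; 5F; 6F)
open import Data.Fin.Properties using (_≟_; _<?_; any?; all?)
open import Data.Fin.Subset using (Subset; inside; outside; Nonempty; Empty; _∩_)
  renaming (_∈_ to _∈ˢ_)
open import Data.Fin.Subset.Properties using (nonempty?) renaming (_∈?_ to _∈ˢ?_)
open import Data.List as List using (List; []; _∷_; _++_; [_]; filter; length; zip; concatMap; cartesianProductWith; allFin)
open import Data.List.NonEmpty as List⁺ using (List⁺; _∷_)
open import Data.List.Relation.Unary.All as All using (All)
open import Data.List.Relation.Unary.AllPairs using (AllPairs; allPairs?)
open import Data.List.Relation.Unary.Any as Any using (Any; here)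
open import Data.Nat using (ℕ; zero; suc)
open import Data.Product using (∃; ∃-syntax; _×_; _,_)
open import Data.Sum using (_⊎_; inj₁; inj₂)
open import Data.Vec as Vec using (Vec; []; _∷_; lookup; toList)
open import Data.Vec.Properties using (≡-dec)
open import Data.Vec.Membership.Propositional using () renaming (_∈_ to _∈ᵛ_)
open import Data.Vec.Relation.Unary.Any using (here; there)
import Data.Vec.Relation.Unary.All as Allᵛ
import Data.Vec.Relation.Unary.AllPairs as AllPairsᵛ
open import Data.Vec.Relation.Unary.Unique.Propositional using (Unique)
open import Level using (0ℓ)
open import Relation.Binary.PropositionalEquality using (_≡_; refl)
open import Relation.Nullary using (¬_; Dec; yes; no; map′; _×-dec_; ¬?)
open import Relation.Unary using (Pred; Decidable)

-- The set [n] = {1,…,n} is represented by Fin n, the number i being i - 1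
-- there.  The same shift applies to the letters of arrow patterns.

------------------------------------------------------------------------
-- Enumerations

vectors : ∀ {A : Set} → List A → (m : ℕ) → List (Vec A m)
vectors as zero    = [ [] ]
vectors as (suc m) = cartesianProductWith _∷_ as (vectors as m)

sublists : ∀ {A : Set} → List A → List (List A)
sublists []       = [ [] ]
sublists (a ∷ as) = List.map (a ∷_) (sublists as) ++ sublists as

anyVec? : ∀ {n m} {P : Pred (Vec (Fin n) m) 0ℓ} → Decidable P → Dec (∃ P)
anyVec? {m = zero}  P? = map′ (λ p → [] , p) (λ { ([] , p) → p }) (P? [])
anyVec? {m = suc m} P? =
  map′ (λ { (i , v , p) → i ∷ v , p }) (λ { (i ∷ v , p) → i , v , p })
       (any? λ i → anyVec? λ v → P? (i ∷ v))

------------------------------------------------------------------------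
-- Permutations in one-line notation

Word : ℕ → Set
Word n = Vec (Fin n) n

unique? : ∀ {n m} → Decidable (Unique {A = Fin n} {n = m})
unique? = AllPairsᵛ.allPairs? λ i j → ¬? (i ≟ j)

-- A word of length n over [n] is a permutation when its entries are distinct.

permutations : (n : ℕ) → List (Word n)
permutations n = filter unique? (vectors (allFin n) n)

------------------------------------------------------------------------
-- The permutation π̂

-- continue c w splits w at its entries that exceed c and all entries before
-- them.  The first component is the part of w before any such entry, i.e. the
-- remainder of the cycle that begins with c.

continue : ∀ {n} → Fin n → List (Fin n) → List (Fin n) × List (List⁺ (Fin n))
continue c []      = [] , []
continue c (a ∷ w) with c <? a
... | yes _ = let (rest , later) = continue a w in [] , (a ∷ rest) ∷ later
... | no  _ = let (rest , later) = continue c w in a ∷ rest , later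

cycles : ∀ {n} → List (Fin n) → List (List⁺ (Fin n))
cycles []      = []
cycles (a ∷ w) = let (rest , later) = continue a w in (a ∷ rest) ∷ later

-- c₁ ↦ c₂ ↦ ⋯ ↦ cₛ ↦ c₁

cycleArrows : ∀ {n} → List⁺ (Fin n) → List (Fin n × Fin n)
cycleArrows (c ∷ cs) = zip (c ∷ cs) (cs ++ [ c ])

-- The image of a under a list of arrows, a being fixed if it has none (which
-- does not happen for the cycles of a permutation).

image : ∀ {n} → List (Fin n × Fin n) → Fin n → Fin n
image []             a = a
image ((b , c) ∷ as) a with a ≟ b
... | yes _ = c
... | no  _ = image as a

hat : ∀ {n} → Word n → Fin n → Fin n
hat π = image (concatMap cycleArrows (cycles (toList π)))

-- For π = 2537164, the cycle form of π̂ is (2)(53)(7164).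

private
  π₀ : Word 7
  π₀ = 1F ∷ 4F ∷ 2F ∷ 6F ∷ 0F ∷ 5F ∷ 3F ∷ []

  cycles-π₀ : List.map List⁺.toList (cycles (toList π₀)) ≡
              (1F ∷ []) ∷ (4F ∷ 2F ∷ []) ∷ (6F ∷ 0F ∷ 5F ∷ 3F ∷ []) ∷ []
  cycles-π₀ = refl

------------------------------------------------------------------------
-- Arrow patterns

record ArrowPattern (k : ℕ) : Set where
  field
    {m}      : ℕ
    ν        : Vec (Fin k) m
    H        : List (Fin k × Fin k)
    distinct : Unique ν
    covers   : ∀ i → i ∈ᵛ ν ⊎ Any (λ (b , c) → i ≡ b ⊎ i ≡ c) H

Increasing : ∀ {n m} → Pred (Vec (Fin n) m) 0ℓ
Increasing = AllPairsᵛ.AllPairs _<_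

increasing? : ∀ {n m} → Decidable (Increasing {n} {m})
increasing? = AllPairsᵛ.allPairs? _<?_

module _ {k n : ℕ} (p : ArrowPattern k) where
  open ArrowPattern p

  Occurrence : Word n → Vec (Fin n) k → Vec (Fin n) m → Set
  Occurrence π x t =
    Increasing x × Increasing t ×
    Vec.map (lookup π) t ≡ Vec.map (lookup x) ν ×
    All (λ (b , c) → hat π (lookup x b) ≡ lookup x c) H

  Contains : Word n → Set
  Contains π = ∃[ x ] ∃[ t ] Occurrence π x t

  Avoids : Word n → Set
  Avoids π = ¬ Contains π

  contains? : Decidable Contains
  contains? π = anyVec? λ x → anyVec? λ t →
    increasing? x ×-dec increasing? t ×-dec
    ≡-dec _≟_ _ _ ×-dec
    All.all? (λ (b , c) → hat π (lookup x b) ≟ lookup x c) H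

  avoids? : Decidable Avoids
  avoids? π = ¬? (contains? π)

avoiders : ∀ {k} (n : ℕ) → ArrowPattern k → List (Word n)
avoiders n p = filter (avoids? p) (permutations n)

-- (23; 2 → 1)

23∶2→1 : ArrowPattern 3
23∶2→1 = record
  { ν        = 1F ∷ 2F ∷ []
  ; H        = [ (1F , 0F) ]
  ; distinct = ((λ ()) Allᵛ.∷ Allᵛ.[]) AllPairsᵛ.∷ (Allᵛ.[] AllPairsᵛ.∷ AllPairsᵛ.[])
  ; covers   = λ { 0F → inj₂ (here (inj₂ refl))
                 ; 1F → inj₁ (here refl)
                 ; 2F → inj₁ (there (here refl)) }
  }

------------------------------------------------------------------------
-- Set partitions and Bell numbers

Disjoint : ∀ {n} → Subset n → Subset n → Set
Disjoint B C = Empty (B ∩ C)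

IsSetPartition : ∀ {n} → Pred (List (Subset n)) 0ℓ
IsSetPartition {n} F =
  All Nonempty F × AllPairs Disjoint F × (∀ (i : Fin n) → Any (i ∈ˢ_) F)

isSetPartition? : ∀ {n} → Decidable (IsSetPartition {n})
isSetPartition? F =
  All.all? nonempty? F ×-dec
  allPairs? (λ B C → ¬? (nonempty? (B ∩ C))) F ×-dec
  all? (λ i → Any.any? (i ∈ˢ?_) F)

subsets : (n : ℕ) → List (Subset n)
subsets = vectors (inside ∷ outside ∷ [])

-- A set of subsets of [n] is represented by the sublist of its members in the
-- duplicate-free list subsets n, so that each one is listed exactly once.

setPartitions : (n : ℕ) → List (List (Subset n))
setPartitions n = filter isSetPartition? (sublists (subsets n))

bell : ℕ → ℕ
bell n = length (setPartitions n)

{-# OPTIONS --safe #-}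

-- The letter b after a in π is π̂(a) unless b is a left-to-right maximum, when
-- π̂(a) ≥ a.  Hence π̂(a) < a exactly when a is a descent top, and π avoids
-- (23; 2 → 1) iff no descent top has a larger letter anywhere to its right.
-- Then each ascending run has a larger maximum than the runs after it,
-- so π is recovered from the set of its runs by sorting them by their maxima,
-- and every set partition of [n] is the set of runs of such a permutation.

module Submission where

open import Defs
open import Data.Bool as Bool using (true; false)
open import Data.Fin using (Fin; zero; suc; _<_; _≤_)
open import Data.Fin.Properties
  using (_≟_; _<?_; <-cmp; <-trans; <-asym; <-irrefl; ≤-refl; ≤-total; injective⇒≤)
open import Data.Fin.Subset using (Subset; Nonempty)
  renaming (_∈_ to _∈ˢ_)
open import Data.Fin.Subset.Properties using (⊆-antisym; x∈p∩q⁺; x∈p∩q⁻)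
  renaming (_∈?_ to _∈ˢ?_)
open import Data.List
  using (List; []; _∷_; _++_; [_]; _∷ʳ_; length; map; concat; concatMap; filter; zip; allFin)
open import Data.List.Membership.Propositional using (_∈_; _∉_; find; lose)
open import Data.List.Membership.Propositional.Properties
  using (∈-map⁺; ∈-map⁻; ∈-++⁺ˡ; ∈-++⁺ʳ; ∈-++⁻; ∈-concat⁺′; ∈-concat⁺; ∈-concat⁻; ∈-filter⁺; ∈-filter⁻;
         ∈-allFin; ∈-cartesianProductWith⁺)
open import Data.List.Membership.Propositional.Properties.WithK using (unique∧set⇒bag)
import Data.List.Membership.DecPropositional as DecMembership
open import Data.List.Properties
  using (∷-injectiveʳ; ++-assoc; length-tabulate; length-map; map-∘; map-id-local)
open import Data.List.Relation.Binary.BagAndSetEquality using (∼bag⇒↭)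
open import Data.List.Relation.Binary.Permutation.Propositional
  using (_↭_; prep; swap; ↭-refl; ↭-sym; ↭-trans; ↭⇒↭ₛ)
open import Data.List.Relation.Binary.Permutation.Propositional.Properties
  using (All-resp-↭; Any-resp-↭; ∈-resp-↭; ↭-length)
import Data.List.Relation.Binary.Permutation.Setoid.Properties as PermutationSetoid
open import Data.List.Relation.Binary.Subset.Propositional using (_⊆_)
open import Data.List.Relation.Unary.All as All using (All; []; _∷_)
import Data.List.Relation.Unary.All.Properties as All
open import Data.List.Relation.Unary.AllPairs as AllPairs using (AllPairs; []; _∷_)
import Data.List.Relation.Unary.AllPairs.Properties as AllPairs
open import Data.List.Relation.Unary.Any as Any using (Any; here; there)
import Data.List.Relation.Unary.Any.Properties as Any
open import Data.List.Relation.Unary.Unique.Propositional using (Unique)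
import Data.List.Relation.Unary.Unique.Propositional.Properties as Unique
open import Data.Nat using (ℕ; zero; suc; _≥_; z<s; s<s)
import Data.Nat.Properties as ℕ
open import Data.Product using (∃₂; ∃-syntax; _×_; _,_; proj₁; proj₂; map₂)
open import Data.Sum using (_⊎_; inj₁; inj₂)
open import Data.Vec as Vec using (Vec; []; _∷_; lookup; toList; tabulate)
open import Data.Vec.Properties as Vec
  using ([]=⇒lookup; lookup⇒[]=; lookup∘tabulate)
open import Data.Vec.Membership.Propositional.Properties using (∈-lookup; ∈-toList⁺; ∈-toList⁻)
import Data.Vec.Relation.Unary.Any.Properties as Anyᵛ
import Data.Vec.Relation.Unary.Any as Anyᵛ
open import Data.Vec.Relation.Unary.All using ([]; _∷_)
import Data.Vec.Relation.Unary.All.Properties as Allᵛ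
open import Data.Vec.Relation.Unary.AllPairs using ([]; _∷_)
import Data.Vec.Relation.Unary.Unique.Propositional as Uniqueᵛ
import Data.Vec.Relation.Unary.Unique.Propositional.Properties as Uniqueᵛ
open import Function using (_∘_; id; _on_; mk⇔)
open import Relation.Binary using (Asymmetric; Transitive; Symmetric; tri<; tri≈; tri>)
open import Relation.Binary.PropositionalEquality
  using (_≡_; refl; sym; trans; cong; subst; resp₂; setoid)
open import Relation.Nullary using (¬_; yes; no; does; contradiction)
open import Relation.Nullary.Decidable using (dec-true; decidable-stable)
open import Relation.Unary using (Decidable)

private
  variable
    A B : Set
    n : ℕ
    xs ys : List A

-- Lists up to reordering

unique∧set⇒↭ : Unique xs → Unique ys → xs ⊆ ys → ys ⊆ xs → xs ↭ ys
unique∧set⇒↭ xs! ys! xs⊆ys ys⊆xs = ∼bag⇒↭ (unique∧set⇒bag xs! ys! (mk⇔ xs⊆ys ys⊆xs))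

map-unique : (f : A → B) → (∀ {x y} → x ∈ xs → y ∈ xs → f x ≡ f y → x ≡ y) →
             Unique xs → Unique (map f xs)
map-unique f inj []         = []
map-unique f inj (x∉ ∷ xs!) =
  All.map⁺ (All.tabulate λ y∈ fx≡fy → All.lookup x∉ y∈ (inj (here refl) (there y∈) fx≡fy)) ∷
  map-unique f (λ x∈ y∈ → inj (there x∈) (there y∈)) xs!

bijection⇒length≡ : {xs : List A} {ys : List B} (f : A → B) → Unique xs → Unique ys →
                    (∀ {x} → x ∈ xs → f x ∈ ys) →
                    (∀ {x y} → x ∈ xs → y ∈ xs → f x ≡ f y → x ≡ y) →
                    (∀ {y} → y ∈ ys → ∃[ x ] x ∈ xs × f x ≡ y) →
                    length xs ≡ length ys
bijection⇒length≡ {xs = xs} {ys} f xs! ys! into inj onto =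
  trans (sym (length-map f xs))
        (↭-length (unique∧set⇒↭ (map-unique f inj xs!) ys! map⊆ ⊆map))
  where
  map⊆ : map f xs ⊆ ys
  map⊆ y∈ with x , x∈ , refl ← ∈-map⁻ f y∈ = into x∈
  ⊆map : ys ⊆ map f xs
  ⊆map y∈ with x , x∈ , refl ← onto y∈ = ∈-map⁺ f x∈

sorted-heads≡ : {R : A → A → Set} → Asymmetric R → ∀ {x y} → All (R x) xs → All (R y) ys →
                x ∈ y ∷ ys → y ∈ x ∷ xs → x ≡ y
sorted-heads≡ asym _  _  (here x≡y) _          = x≡y
sorted-heads≡ asym _  _  (there _)  (here y≡x) = sym y≡x
sorted-heads≡ asym x< y< (there x∈) (there y∈) =
  contradiction (All.lookup x< y∈) (asym (All.lookup y< x∈))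

sorted-unique : {R : A → A → Set} → Asymmetric R → AllPairs R xs → AllPairs R ys →
                xs ⊆ ys → ys ⊆ xs → xs ≡ ys
sorted-unique asym []         []         _   _   = refl
sorted-unique asym []         (_ ∷ _)    _   ys⊆ = contradiction (ys⊆ (here refl)) λ ()
sorted-unique asym (_ ∷ _)    []         xs⊆ _   = contradiction (xs⊆ (here refl)) λ ()
sorted-unique {R = R} asym (x< ∷ xs↗) (y< ∷ ys↗) xs⊆ ys⊆
  with refl ← sorted-heads≡ asym x< y< (xs⊆ (here refl)) (ys⊆ (here refl)) =
  cong (_ ∷_) (sorted-unique asym xs↗ ys↗ (strip x< xs⊆) (strip y< ys⊆))
  where
  strip : ∀ {z zs ws} → All (R z) zs → z ∷ zs ⊆ z ∷ ws → zs ⊆ ws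
  strip z< zs⊆ u∈ with zs⊆ (there u∈)
  ... | there u∈ws = u∈ws
  ... | here refl  = contradiction (All.lookup z< u∈) (λ r → asym r r)

insert-sorted : {R : A → A → Set} → Transitive R → ∀ x {xs} →
                All (λ y → R x y ⊎ R y x) xs → AllPairs R xs →
                ∃[ ys ] ys ↭ x ∷ xs × AllPairs R ys
insert-sorted trans x []              []         = [ x ] , ↭-refl , [] ∷ []
insert-sorted trans x (inj₁ Rxy ∷ _)  (y< ∷ xs↗) =
  _ , ↭-refl , (Rxy ∷ All.map (trans Rxy) y<) ∷ y< ∷ xs↗
insert-sorted trans x (inj₂ Ryx ∷ cs) (y< ∷ xs↗)
  with zs , zs↭ , zs↗ ← insert-sorted trans x cs xs↗ =
  _ , ↭-trans (prep _ zs↭) (swap _ _ ↭-refl) , All-resp-↭ (↭-sym zs↭) (Ryx ∷ y<) ∷ zs↗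

sort-comparable : {R : A → A → Set} → Transitive R →
                  AllPairs (λ x y → R x y ⊎ R y x) xs → ∃[ ys ] ys ↭ xs × AllPairs R ys
sort-comparable trans []        = [] , ↭-refl , []
sort-comparable trans (cs ∷ ps)
  with ys , ys↭ , ys↗ ← sort-comparable trans ps
  with zs , zs↭ , zs↗ ← insert-sorted trans _ (All-resp-↭ (↭-sym ys↭) cs) ys↗ =
  zs , ↭-trans zs↭ (prep _ ys↭) , zs↗

AllPairs-resp-↭ : {R : A → A → Set} → Symmetric R → xs ↭ ys → AllPairs R xs → AllPairs R ys
AllPairs-resp-↭ {R = R} R-sym xs↭ys =
  PermutationSetoid.AllPairs-resp-↭ (setoid _) R-sym (resp₂ R) (↭⇒↭ₛ xs↭ys)

Unique-++⁻ : ∀ (xs : List A) {ys} → Unique (xs ++ ys) →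
             Unique ys × (∀ {x} → x ∈ xs → x ∉ ys)
Unique-++⁻ []       ys!         = ys! , λ ()
Unique-++⁻ (x ∷ xs) (x∉ ∷ xys!) with ys! , disj ← Unique-++⁻ xs xys! =
  ys! , λ { (here refl) x∈ys → All.lookup x∉ (∈-++⁺ʳ xs x∈ys) refl
          ; (there x∈xs) → disj x∈xs }

-- Enumerations

∈-vectors : ∀ {as : List A} → (∀ a → a ∈ as) → ∀ {m} (v : Vec A m) → v ∈ vectors as m
∈-vectors all∈ []      = here refl
∈-vectors all∈ (a ∷ v) = ∈-cartesianProductWith⁺ _∷_ (all∈ a) (∈-vectors all∈ v)

vectors-unique : ∀ {as : List A} → Unique as → ∀ m → Unique (vectors as m)
vectors-unique as! zero    = [] ∷ []
vectors-unique as! (suc m) =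
  Unique.cartesianProductWith⁺ _∷_ Vec.∷-injective as! (vectors-unique as! m)

∈-sublists⇒⊆ : ∀ {xs ys : List A} → ys ∈ sublists xs → ys ⊆ xs
∈-sublists⇒⊆ {xs = []}     (here refl) ()
∈-sublists⇒⊆ {xs = x ∷ xs} ys∈ y∈ with ∈-++⁻ (map (x ∷_) (sublists xs)) ys∈
... | inj₂ ys∈′ = there (∈-sublists⇒⊆ ys∈′ y∈)
... | inj₁ ys∈′ with zs , zs∈ , refl ← ∈-map⁻ (x ∷_) ys∈′ with y∈
...   | here refl = here refl
...   | there y∈′ = there (∈-sublists⇒⊆ zs∈ y∈′)

filter∈sublists : {P : A → Set} (P? : Decidable P) (xs : List A) → filter P? xs ∈ sublists xs
filter∈sublists P? []       = here refl
filter∈sublists P? (x ∷ xs) with does (P? x)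
... | true  = ∈-++⁺ˡ (∈-map⁺ (x ∷_) (filter∈sublists P? xs))
... | false = ∈-++⁺ʳ (map (x ∷_) (sublists xs)) (filter∈sublists P? xs)

∈-sublists⇒unique : Unique xs → ∀ {ys} → ys ∈ sublists xs → Unique ys
∈-sublists⇒unique []         (here refl) = []
∈-sublists⇒unique {xs = x ∷ xs} (x∉ ∷ xs!) ys∈ with ∈-++⁻ (map (x ∷_) (sublists xs)) ys∈
... | inj₂ ys∈′ = ∈-sublists⇒unique xs! ys∈′
... | inj₁ ys∈′ with zs , zs∈ , refl ← ∈-map⁻ (x ∷_) ys∈′ =
  All.anti-mono (∈-sublists⇒⊆ zs∈) x∉ ∷ ∈-sublists⇒unique xs! zs∈

sublists-unique : Unique xs → Unique (sublists xs)
sublists-unique []                      = [] ∷ []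
sublists-unique {xs = x ∷ xs} (x∉ ∷ xs!) =
  Unique.++⁺ (Unique.map⁺ ∷-injectiveʳ (sublists-unique xs!)) (sublists-unique xs!) disjoint
  where
  disjoint : ∀ {ys} → ¬ (ys ∈ map (x ∷_) (sublists xs) × ys ∈ sublists xs)
  disjoint (ys∈ , ys∈′) with zs , _ , refl ← ∈-map⁻ (x ∷_) ys∈ =
    All.lookup x∉ (∈-sublists⇒⊆ ys∈′ (here refl)) refl

∈-sublists-ext : Unique xs → ∀ {ys zs} → ys ∈ sublists xs → zs ∈ sublists xs →
                 ys ⊆ zs → zs ⊆ ys → ys ≡ zs
∈-sublists-ext [] (here refl) (here refl) _ _ = refl
∈-sublists-ext {xs = x ∷ xs} (x∉ ∷ xs!) ys∈ zs∈ ys⊆zs zs⊆ys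
  with ∈-++⁻ (map (x ∷_) (sublists xs)) ys∈ | ∈-++⁻ (map (x ∷_) (sublists xs)) zs∈
... | inj₂ ys∈′ | inj₂ zs∈′ = ∈-sublists-ext xs! ys∈′ zs∈′ ys⊆zs zs⊆ys
... | inj₁ ys∈′ | inj₂ zs∈′ with _ , _ , refl ← ∈-map⁻ (x ∷_) ys∈′ =
  contradiction refl (All.lookup x∉ (∈-sublists⇒⊆ zs∈′ (ys⊆zs (here refl))))
... | inj₂ ys∈′ | inj₁ zs∈′ with _ , _ , refl ← ∈-map⁻ (x ∷_) zs∈′ =
  contradiction refl (All.lookup x∉ (∈-sublists⇒⊆ ys∈′ (zs⊆ys (here refl))))
... | inj₁ ys∈′ | inj₁ zs∈′
  with ys′ , ys′∈ , refl ← ∈-map⁻ (x ∷_) ys∈′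
  with zs′ , zs′∈ , refl ← ∈-map⁻ (x ∷_) zs∈′ =
  cong (x ∷_) (∈-sublists-ext xs! ys′∈ zs′∈ (strip ys′∈ ys⊆zs) (strip zs′∈ zs⊆ys))
  where
  strip : ∀ {us ws} → us ∈ sublists xs → x ∷ us ⊆ x ∷ ws → us ⊆ ws
  strip us∈ us⊆ u∈ with us⊆ (there u∈)
  ... | there u∈ws = u∈ws
  ... | here refl  = contradiction refl (All.lookup x∉ (∈-sublists⇒⊆ us∈ u∈))

-- Vectors and their lists

toList-unique : ∀ {m} {v : Vec A m} → Uniqueᵛ.Unique v → Unique (toList v)
toList-unique []        = []
toList-unique (a∉ ∷ v!) = Allᵛ.toList⁺ a∉ ∷ toList-unique v!

toList-unique⁻ : ∀ {m} {v : Vec A m} → Unique (toList v) → Uniqueᵛ.Unique v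
toList-unique⁻ {v = []}    []        = []
toList-unique⁻ {v = _ ∷ _} (a∉ ∷ v!) = Allᵛ.toList⁻ a∉ ∷ toList-unique⁻ v!

toList-surjective : ∀ (w : List A) {m} → length w ≡ m → ∃[ v ] toList {n = m} v ≡ w
toList-surjective w refl = Vec.fromList w , Vec.toList∘fromList w

toList-inj : ∀ {m} (v v′ : Vec A m) → toList v ≡ toList v′ → v ≡ v′
toList-inj v v′ eq = trans (sym (Vec.cast-is-id refl v)) (Vec.toList-injective refl v v′ eq)

permutation-covers : ∀ (π : Word n) → Uniqueᵛ.Unique π → ∀ i → i ∈ toList π
permutation-covers {n} π π! i = decidable-stable (i ∈? toList π) λ i∉ →
  ℕ.1+n≰n (injective⇒≤ {f = lookup (i ∷ π)} (Uniqueᵛ.lookup-injective (i∷π! i∉) _ _))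
  where
  open DecMembership (_≟_ {n}) using (_∈?_)
  i∷π! : i ∉ toList π → Uniqueᵛ.Unique (i ∷ π)
  i∷π! i∉ = toList-unique⁻ (All.tabulate (λ { j∈ refl → i∉ j∈ }) ∷ toList-unique π!)

covering-length : ∀ {w : List (Fin n)} → Unique w → (∀ i → i ∈ w) → length w ≡ n
covering-length {n} w! all∈ = trans
  (↭-length (unique∧set⇒↭ w! (Unique.allFin⁺ n) (λ {i} _ → ∈-allFin i) (λ {i} _ → all∈ i)))
  (length-tabulate id)

toList-lookup⁺ : ∀ {m} (v : Vec A m) {s t} → s < t →
                 ∃₂ λ us ws → toList v ≡ us ++ lookup v s ∷ ws × lookup v t ∈ ws
toList-lookup⁺ (a ∷ v) {zero}  {suc t} s<t = [] , toList v , refl , ∈-toList⁺ (∈-lookup t v)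
toList-lookup⁺ (a ∷ v) {suc s} {suc t} (s<s s<t) with us , ws , eq , t∈ ← toList-lookup⁺ v s<t =
  a ∷ us , ws , cong (a ∷_) eq , t∈

toList-lookup⁻ : ∀ {m} (v : Vec A m) us {a b ws} → toList v ≡ us ++ a ∷ ws → b ∈ ws →
                 ∃₂ λ s t → s < t × lookup v s ≡ a × lookup v t ≡ b
toList-lookup⁻ (a ∷ v) []       refl b∈ =
  zero , suc (Anyᵛ.index (∈-toList⁻ b∈)) , z<s , refl , sym (Anyᵛ.lookup-index (∈-toList⁻ b∈))
toList-lookup⁻ (a ∷ v) (_ ∷ us) eq   b∈
  with s , t , s<t , eq₁ , eq₂ ← toList-lookup⁻ v us (∷-injectiveʳ eq) b∈ =
  suc s , suc t , s<s s<t , eq₁ , eq₂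

-- Subsets as ascending lists

elements : Subset n → List (Fin n)
elements B = filter (_∈ˢ? B) (allFin _)

∈-elements⁺ : ∀ {B : Subset n} {i} → i ∈ˢ B → i ∈ elements B
∈-elements⁺ {B = B} = ∈-filter⁺ (_∈ˢ? B) (∈-allFin _)

∈-elements⁻ : ∀ {B : Subset n} {i} → i ∈ elements B → i ∈ˢ B
∈-elements⁻ {B = B} i∈ = proj₂ (∈-filter⁻ (_∈ˢ? B) {xs = allFin _} i∈)

Ascending : List (Fin n) → Set
Ascending = AllPairs _<_

elements-ascending : (B : Subset n) → Ascending (elements B)
elements-ascending B = AllPairs.filter⁺ (_∈ˢ? B) (AllPairs.tabulate⁺-< id)

module _ {n : ℕ} where
  open DecMembership (_≟_ {n}) using (_∈?_)

  fromElements : List (Fin n) → Subset n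
  fromElements r = tabulate λ i → does (i ∈? r)

  ∈-fromElements⁺ : ∀ {r i} → i ∈ r → i ∈ˢ fromElements r
  ∈-fromElements⁺ {r} {i} i∈ =
    lookup⇒[]= i _ (trans (lookup∘tabulate _ i) (dec-true (i ∈? r) i∈))

  ∈-fromElements⁻ : ∀ {r i} → i ∈ˢ fromElements r → i ∈ r
  ∈-fromElements⁻ {r} {i} i∈ with i ∈? r | trans (sym (lookup∘tabulate (λ i → does (i ∈? r)) i)) ([]=⇒lookup i∈)
  ... | yes i∈r | _ = i∈r
  ... | no _    | ()

fromElements-elements : (B : Subset n) → fromElements (elements B) ≡ B
fromElements-elements B =
  ⊆-antisym (∈-elements⁻ ∘ ∈-fromElements⁻) (∈-fromElements⁺ ∘ ∈-elements⁺)

elements-fromElements : ∀ {r : List (Fin n)} → Ascending r → elements (fromElements r) ≡ r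
elements-fromElements {r = r} r↗ = sorted-unique <-asym (elements-ascending (fromElements r)) r↗
  (∈-fromElements⁻ ∘ ∈-elements⁻) (∈-elements⁺ ∘ ∈-fromElements⁺)

-- Ascending runs

-- The clause for [] ∷ rs is never reached from runs.

push : Fin n → List (List (Fin n)) → List (List (Fin n))
push a []             = [ a ] ∷ []
push a ([] ∷ rs)      = [ a ] ∷ rs
push a ((b ∷ r) ∷ rs) with a <? b
... | yes _ = (a ∷ b ∷ r) ∷ rs
... | no  _ = [ a ] ∷ (b ∷ r) ∷ rs

runs : List (Fin n) → List (List (Fin n))
runs []      = []
runs (a ∷ w) = push a (runs w)

push-head : ∀ (a : Fin n) rs → ∃₂ λ r rs′ → push a rs ≡ (a ∷ r) ∷ rs′
push-head a []             = _ , _ , refl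
push-head a ([] ∷ rs)      = _ , _ , refl
push-head a ((b ∷ r) ∷ rs) with a <? b
... | yes _ = _ , _ , refl
... | no  _ = _ , _ , refl

concat-push : ∀ (a : Fin n) rs → concat (push a rs) ≡ a ∷ concat rs
concat-push a []             = refl
concat-push a ([] ∷ rs)      = refl
concat-push a ((b ∷ r) ∷ rs) with a <? b
... | yes _ = refl
... | no  _ = refl

concat-runs : (w : List (Fin n)) → concat (runs w) ≡ w
concat-runs []      = refl
concat-runs (a ∷ w) = trans (concat-push a (runs w)) (cong (a ∷_) (concat-runs w))

runs-ascending : (w : List (Fin n)) → All Ascending (runs w)
runs-ascending []      = []
runs-ascending (a ∷ w) = push-ascending (runs w) (runs-ascending w)
  where
  push-ascending : ∀ rs → All Ascending rs → All Ascending (push a rs)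
  push-ascending []             _                  = ([] ∷ []) ∷ []
  push-ascending ([] ∷ rs)      (_ ∷ rs↗)          = ([] ∷ []) ∷ rs↗
  push-ascending ((b ∷ r) ∷ rs) ((b< ∷ r↗) ∷ rs↗) with a <? b
  ... | yes a<b = ((a<b ∷ All.map (<-trans a<b) b<) ∷ b< ∷ r↗) ∷ rs↗
  ... | no  _   = ([] ∷ []) ∷ (b< ∷ r↗) ∷ rs↗

runs-nonempty : (w : List (Fin n)) → All (λ r → ∃[ i ] i ∈ r) (runs w)
runs-nonempty []      = []
runs-nonempty (a ∷ w) = push-nonempty (runs w) (runs-nonempty w)
  where
  push-nonempty : ∀ rs → All (λ r → ∃[ i ] i ∈ r) rs → All (λ r → ∃[ i ] i ∈ r) (push a rs)
  push-nonempty []             _        = (a , here refl) ∷ []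
  push-nonempty ([] ∷ rs)      (_ ∷ ne) = (a , here refl) ∷ ne
  push-nonempty ((b ∷ r) ∷ rs) (_ ∷ ne) with a <? b
  ... | yes _ = (a , here refl) ∷ ne
  ... | no  _ = (a , here refl) ∷ (b , here refl) ∷ ne

-- For nonempty r and s this says max r > max s.

_≻_ : List (Fin n) → List (Fin n) → Set
r ≻ s = Any (λ i → All (_< i) s) r

≻-asym : Asymmetric (_≻_ {n})
≻-asym r≻s s≻r with i , i∈r , s<i ← find r≻s with j , j∈s , r<j ← find s≻r =
  <-asym (All.lookup s<i j∈s) (All.lookup r<j i∈r)

≻-++ : ∀ {r s t : List (Fin n)} → r ≻ s → s ≻ t → r ≻ (s ++ t)
≻-++ r≻s s≻t with j , j∈s , t<j ← find s≻t =
  Any.map (λ s<i → All.++⁺ s<i (All.map (λ k<j → <-trans k<j (All.lookup s<i j∈s)) t<j)) r≻s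

≻-trans : Transitive (_≻_ {n})
≻-trans {i = r} {j = s} r≻s s≻t = Any.map (All.++⁻ʳ s) (≻-++ {r = r} r≻s s≻t)

≻-concat : ∀ {r : List (Fin n)} {rs} → ∃[ i ] i ∈ r → AllPairs _≻_ (r ∷ rs) →
           All (λ r → ∃[ i ] i ∈ r) rs → r ≻ concat rs
≻-concat (_ , i∈)     (_ ∷ [])                 []        = Any.map (λ _ → []) i∈
≻-concat {r = r} _    ((r≻s ∷ _) ∷ s≻ ∷ rs↘) (s≠[] ∷ ne) =
  ≻-++ {r = r} r≻s (≻-concat s≠[] (s≻ ∷ rs↘) ne)

maximum : ∀ (a : Fin n) r → ∃[ m ] m ∈ a ∷ r × All (_≤ m) (a ∷ r)
maximum a []      = a , here refl , ≤-refl ∷ []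
maximum a (b ∷ r) with m , m∈ , r≤m ← maximum b r with ≤-total a m
... | inj₁ a≤m = m , there m∈ , a≤m ∷ r≤m
... | inj₂ m≤a = a , here refl , ≤-refl ∷ All.map (λ k≤m → ℕ.≤-trans k≤m m≤a) r≤m

≻-total : ∀ {r s : List (Fin n)} → ∃[ i ] i ∈ r → ∃[ j ] j ∈ s →
          (∀ {i} → i ∈ r → i ∉ s) → r ≻ s ⊎ s ≻ r
≻-total {r = a ∷ r} {b ∷ s} _ _ disj
  with i , i∈ , r≤i ← maximum a r with j , j∈ , s≤j ← maximum b s with <-cmp i j
... | tri< i<j _ _  = inj₂ (lose j∈ (All.map (λ k≤i → ℕ.≤-<-trans k≤i i<j) r≤i))
... | tri≈ _ refl _ = contradiction j∈ (disj i∈)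
... | tri> _ _ j<i  = inj₁ (lose i∈ (All.map (λ k≤j → ℕ.≤-<-trans k≤j j<i) s≤j))
≻-total {r = []}             (_ , ()) _
≻-total {r = _ ∷ _} {s = []} _ (_ , ())

-- The vincular pattern 21-3, in which only 2 and 1 must be adjacent.

data Avoids21-3 {n : ℕ} : List (Fin n) → Set where
  []     : Avoids21-3 []
  max    : ∀ {a w} → All (_< a) w → Avoids21-3 w → Avoids21-3 (a ∷ w)
  ascent : ∀ {a b w} → a < b → Avoids21-3 (b ∷ w) → Avoids21-3 (a ∷ b ∷ w)

runs-descending : ∀ {w : List (Fin n)} → Avoids21-3 w → AllPairs _≻_ (runs w)
runs-descending []            = []
runs-descending {w = a ∷ w} (max w<a av) =
  push-max (runs w) (subst (All (_< a)) (sym (concat-runs w)) w<a) (runs-descending av)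
  where
  push-max : ∀ rs → All (_< a) (concat rs) → AllPairs _≻_ rs → AllPairs _≻_ (push a rs)
  push-max []             _         _             = [] ∷ []
  push-max ([] ∷ rs)      rs<a      (_ ∷ rs↘)     = All.map here (All.concat⁻ rs<a) ∷ rs↘
  push-max ((b ∷ r) ∷ rs) (b<a ∷ rs<a) rs↘ with a <? b
  ... | yes a<b = contradiction a<b (<-asym b<a)
  ... | no  _   = All.map here (All.concat⁻ {xss = (b ∷ r) ∷ rs} (b<a ∷ rs<a)) ∷ rs↘
runs-descending {w = a ∷ b ∷ w} (ascent a<b av) with push-head b (runs w) | runs-descending av
... | r , rs , eq | rs↘ rewrite eq with a <? b | rs↘
...   | yes _  | r≻ ∷ rs↘′ = All.map there r≻ ∷ rs↘′
...   | no a≮b | _         = contradiction a<b a≮b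

≻-tail : ∀ {a b : Fin n} {r w} → a < b → (a ∷ b ∷ r) ≻ w → (b ∷ r) ≻ w
≻-tail a<b (here w<a)  = here (All.map (λ k<a → <-trans k<a a<b) w<a)
≻-tail a<b (there r≻w) = r≻w

runs-++ : ∀ {a : Fin n} {r w} → Ascending (a ∷ r) → (a ∷ r) ≻ w →
          runs ((a ∷ r) ++ w) ≡ (a ∷ r) ∷ runs w
runs-++ {r = []}    {[]}    _ _ = refl
runs-++ {a = a} {r = []} {b ∷ w} _ (here (b<a ∷ _))
  with r , rs , eq ← push-head b (runs w) rewrite eq with a <? b
... | yes a<b = contradiction a<b (<-asym b<a)
... | no  _   = refl
runs-++ {a = a} {r = b ∷ r} ((a<b ∷ _) ∷ r↗) r≻w rewrite runs-++ r↗ (≻-tail a<b r≻w) with a <? b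
... | yes _  = refl
... | no a≮b = contradiction a<b a≮b

avoids21-3-++ : ∀ {a : Fin n} {r w} → Ascending (a ∷ r) → (a ∷ r) ≻ w →
                Avoids21-3 w → Avoids21-3 ((a ∷ r) ++ w)
avoids21-3-++ {r = []}    _                 (here w<a) av = max w<a av
avoids21-3-++ {r = b ∷ r} ((a<b ∷ _) ∷ r↗) r≻w        av =
  ascent a<b (avoids21-3-++ r↗ (≻-tail a<b r≻w) av)

descending-concat : ∀ {rs : List (List (Fin n))} →
                    All (λ r → ∃[ i ] i ∈ r) rs → All Ascending rs → AllPairs _≻_ rs →
                    Avoids21-3 (concat rs) × runs (concat rs) ≡ rs
descending-concat []                        []         []        = [] , refl
descending-concat {rs = [] ∷ _}      ((_ , ()) ∷ _)
descending-concat {rs = (a ∷ r) ∷ _} (r≠[] ∷ ne) (r↗ ∷ rs↗) (r≻ ∷ rs↘)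
  with av , eq ← descending-concat ne rs↗ rs↘ =
  avoids21-3-++ r↗ r≻w av , trans (runs-++ r↗ r≻w) (cong (_ ∷_) eq)
  where r≻w = ≻-concat r≠[] (r≻ ∷ rs↘) ne

-- The pattern (23; 2 → 1)

-- The arrows of the cycles on the letters from p on, where c is the leader of
-- the cycle of p.

arrowsFrom : Fin n → Fin n → List (Fin n) → List (Fin n × Fin n)
arrowsFrom c p w = let (rest , later) = continue c w in
  zip (p ∷ rest) (rest ++ [ c ]) ++ concatMap cycleArrows later

image-arrowsFrom : ∀ us {c p a b : Fin n} {w ws} → p ≤ c → Unique (p ∷ w) →
                   p ∷ w ≡ us ++ a ∷ b ∷ ws →
                   (b < a → image (arrowsFrom c p w) a ≡ b) ×
                   (a < b → a ≤ image (arrowsFrom c p w) a)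
image-arrowsFrom [] {c} {p} {b = b} p≤c _ refl with c <? b
... | yes c<b with p ≟ p
...   | yes _  = (λ b<p → contradiction (ℕ.<-≤-trans b<p p≤c) (<-asym c<b)) , λ _ → p≤c
...   | no p≢p = contradiction refl p≢p
image-arrowsFrom [] {c} {p} {b = b} p≤c _ refl | no _ with p ≟ p
...   | yes _  = (λ _ → refl) , ℕ.<⇒≤
...   | no p≢p = contradiction refl p≢p
image-arrowsFrom (_ ∷ us) {c} {p} {a} {w = []} p≤c _ eq with us | eq
... | []    | ()
... | _ ∷ _ | ()
image-arrowsFrom (_ ∷ us) {c} {p} {a} {w = x ∷ w} p≤c (p∉ ∷ w!) eq with c <? x
... | yes c<x with a ≟ p
...   | no _     = image-arrowsFrom us ≤-refl w! (∷-injectiveʳ eq)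
...   | yes refl =
  contradiction refl (All.lookup p∉ (subst (p ∈_) (sym (∷-injectiveʳ eq)) (∈-++⁺ʳ us (here refl))))
image-arrowsFrom (_ ∷ us) {c} {p} {a} {w = x ∷ w} p≤c (p∉ ∷ w!) eq | no c≮x with a ≟ p
...   | no _     = image-arrowsFrom us (ℕ.≮⇒≥ c≮x) w! (∷-injectiveʳ eq)
...   | yes refl =
  contradiction refl (All.lookup p∉ (subst (p ∈_) (sym (∷-injectiveʳ eq)) (∈-++⁺ʳ us (here refl))))

hat-next : ∀ (π : Word n) → Uniqueᵛ.Unique π → ∀ us {a b ws} → toList π ≡ us ++ a ∷ b ∷ ws →
           (b < a → hat π a ≡ b) × (a < b → a ≤ hat π a)
hat-next []      _  []      ()
hat-next []      _  (_ ∷ _) ()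
hat-next (p ∷ π) π! us      eq = image-arrowsFrom us ≤-refl (toList-unique π!) eq

avoids21-3-tail : ∀ {a : Fin n} {w} → Avoids21-3 (a ∷ w) → Avoids21-3 w
avoids21-3-tail (max _ av)    = av
avoids21-3-tail (ascent _ av) = av

avoids21-3-suffix : ∀ us {w : List (Fin n)} → Avoids21-3 (us ++ w) → Avoids21-3 w
avoids21-3-suffix []       av = av
avoids21-3-suffix (_ ∷ us) av = avoids21-3-suffix us (avoids21-3-tail av)

avoids⇒avoids21-3 : ∀ (π : Word n) → Uniqueᵛ.Unique π → Avoids 23∶2→1 π → Avoids21-3 (toList π)
avoids⇒avoids21-3 {n} π π! avoids = go [] (toList π) refl
  where
  go : ∀ us w → toList π ≡ us ++ w → Avoids21-3 w
  go us []          eq = []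
  go us (a ∷ [])    eq = max [] []
  go us (a ∷ b ∷ w) eq
    with av ← go (us ∷ʳ a) (b ∷ w) (trans eq (sym (++-assoc us [ a ] (b ∷ w))))
       | (a≢b ∷ a∉) ∷ _ ← proj₁ (Unique-++⁻ us (subst Unique eq (toList-unique π!)))
    with <-cmp a b
  ... | tri< a<b _ _ = ascent a<b av
  ... | tri≈ _ a≡b _ = contradiction a≡b a≢b
  ... | tri> _ _ b<a = max (b<a ∷ All.tabulate below) av
    where
    below : ∀ {c} → c ∈ w → c < a
    below {c} c∈ with <-cmp c a
    ... | tri< c<a _ _ = c<a
    ... | tri≈ _ c≡a _ = contradiction (sym c≡a) (All.lookup a∉ c∈)
    ... | tri> _ _ a<c with s , t , s<t , refl , refl ← toList-lookup⁻ π us eq (there c∈) =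
      contradiction
        ( b ∷ lookup π s ∷ lookup π t ∷ [] , s ∷ t ∷ []
        , ((b<a ∷ <-trans b<a a<c ∷ []) ∷ (a<c ∷ []) ∷ [] ∷ [])
        , ((s<t ∷ []) ∷ [] ∷ [])
        , refl
        , proj₁ (hat-next π π! us eq) b<a ∷ [])
        avoids

avoids21-3⇒avoids : ∀ (π : Word n) → Uniqueᵛ.Unique π → Avoids21-3 (toList π) → Avoids 23∶2→1 π
avoids21-3⇒avoids π π! av
  ( x₁ ∷ x₂ ∷ x₃ ∷ [] , s ∷ t ∷ []
  , ((x₁<x₂ ∷ _) ∷ (x₂<x₃ ∷ []) ∷ _) , ((s<t ∷ []) ∷ _) , refl , hat≡x₁ ∷ [])
  with us , ws , eq , x₃∈ ← toList-lookup⁺ π s<t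
  with avoids21-3-suffix us (subst Avoids21-3 eq av)
... | max ws<x₂ _ = <-asym x₂<x₃ (All.lookup ws<x₂ x₃∈)
... | ascent x₂<b _ = ℕ.<⇒≱ x₁<x₂ (subst (lookup π s ≤_) hat≡x₁ (proj₂ (hat-next π π! us eq) x₂<b))

-- The bijection

setPartition-unique : ∀ {F : List (Subset n)} → IsSetPartition F → Unique F
setPartition-unique (ne , disj , _) = go ne disj
  where
  go : ∀ {F} → All Nonempty F → AllPairs Disjoint F → Unique F
  go []                 []            = []
  go ((i , i∈B) ∷ ne) (disj ∷ disjs) =
    All.map (λ { B∩B=∅ refl → B∩B=∅ (i , x∈p∩q⁺ (i∈B , i∈B)) }) disj ∷ go ne disjs

Disjoint-sym : Symmetric (Disjoint {n})
Disjoint-sym {x = B} {C} B∩C=∅ (i , i∈) with i∈C , i∈B ← x∈p∩q⁻ C B i∈ =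
  B∩C=∅ (i , x∈p∩q⁺ (i∈B , i∈C))

setPartition-resp-↭ : ∀ {F G : List (Subset n)} → F ↭ G → IsSetPartition F → IsSetPartition G
setPartition-resp-↭ F↭G (ne , disj , cover) =
  All-resp-↭ F↭G ne ,
  AllPairs-resp-↭ (λ {B} {C} → Disjoint-sym {x = B} {C}) F↭G disj ,
  Any-resp-↭ F↭G ∘ cover

fromElements-isSetPartition : ∀ {rs : List (List (Fin n))} → All (λ r → ∃[ i ] i ∈ r) rs →
                              Unique (concat rs) → (∀ i → i ∈ concat rs) →
                              IsSetPartition (map fromElements rs)
fromElements-isSetPartition {rs = rs} ne rs! all∈ =
  All.map⁺ (All.map (λ (i , i∈) → i , ∈-fromElements⁺ i∈) ne) ,
  AllPairs.map⁺ (disjoint rs rs!) ,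
  λ i → Any.map⁺ (Any.map ∈-fromElements⁺ (∈-concat⁻ rs (all∈ i)))
  where
  disjoint : ∀ rs → Unique (concat rs) → AllPairs (Disjoint on fromElements) rs
  disjoint []       _    = []
  disjoint (r ∷ rs) rrs! with rs! , disj ← Unique-++⁻ r rrs! =
    All.tabulate (λ {s} s∈ (i , i∈) →
      let i∈r , i∈s = x∈p∩q⁻ (fromElements r) (fromElements s) i∈
      in disj (∈-fromElements⁻ i∈r) (∈-concat⁺′ (∈-fromElements⁻ i∈s) s∈))
    ∷ disjoint rs rs!

elements-unique-cover : ∀ {F : List (Subset n)} → IsSetPartition F →
                        Unique (concat (map elements F)) × (∀ i → i ∈ concat (map elements F))
elements-unique-cover (_ , disj , cover) =
  Unique.concat⁺
    (All.map⁺ (All.tabulate λ {B} _ → AllPairs.map (λ i<j i≡j → <-irrefl i≡j i<j) (elements-ascending B)))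
    (AllPairs.map⁺ (AllPairs.map
      (λ disj {i} (i∈B , i∈C) → disj (i , x∈p∩q⁺ (∈-elements⁻ i∈B , ∈-elements⁻ i∈C))) disj)) ,
  λ i → ∈-concat⁺ (Any.map⁺ (Any.map ∈-elements⁺ (cover i)))

map-fromElements-elements : (F : List (Subset n)) → map fromElements (map elements F) ≡ F
map-fromElements-elements F =
  trans (sym (map-∘ F)) (map-id-local (All.tabulate λ {B} _ → fromElements-elements B))

elements-≻-comparable : ∀ {F : List (Subset n)} → IsSetPartition F →
                        AllPairs (λ B C → elements B ≻ elements C ⊎ elements C ≻ elements B) F
elements-≻-comparable (ne , disj , _) = go ne disj
  where
  go : ∀ {F} → All Nonempty F → AllPairs Disjoint F → AllPairs _ F
  go []                []             = []
  go ((i , i∈B) ∷ ne) (disj ∷ disjs) =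
    All.zipWith (λ ((j , j∈C) , B∩C=∅) →
      ≻-total (i , ∈-elements⁺ i∈B) (j , ∈-elements⁺ j∈C)
        (λ k∈B k∈C → B∩C=∅ (_ , x∈p∩q⁺ (∈-elements⁻ k∈B , ∈-elements⁻ k∈C)))) (ne , disj)
    ∷ go ne disjs

∈-subsets : (B : Subset n) → B ∈ subsets n
∈-subsets = ∈-vectors λ { true → here refl ; false → there (here refl) }

subsets-unique : ∀ n → Unique (subsets n)
subsets-unique = vectors-unique (((λ ()) ∷ []) ∷ [] ∷ [])

∈-permutations : ∀ {π : Word n} → Uniqueᵛ.Unique π → π ∈ permutations n
∈-permutations {π = π} = ∈-filter⁺ unique? (∈-vectors ∈-allFin π)

avoiders-unique : ∀ n → Unique (avoiders n 23∶2→1)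
avoiders-unique n = Unique.filter⁺ (avoids? 23∶2→1)
  (Unique.filter⁺ unique? (vectors-unique (Unique.allFin⁺ n) n))

∈-avoiders⁻ : ∀ {π} → π ∈ avoiders n 23∶2→1 → Uniqueᵛ.Unique π × Avoids21-3 (toList π)
∈-avoiders⁻ {n} {π} π∈
  with π∈′ , avoids ← ∈-filter⁻ (avoids? 23∶2→1) {xs = permutations n} π∈
  with _ , π! ← ∈-filter⁻ unique? {xs = vectors (allFin n) n} π∈′ =
  π! , avoids⇒avoids21-3 π π! avoids

∈-avoiders⁺ : ∀ {π} → Uniqueᵛ.Unique π → Avoids21-3 (toList π) → π ∈ avoiders n 23∶2→1
∈-avoiders⁺ {π = π} π! av =
  ∈-filter⁺ (avoids? 23∶2→1) (∈-permutations π!) (avoids21-3⇒avoids π π! av)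

setPartitions-unique : ∀ n → Unique (setPartitions n)
setPartitions-unique n = Unique.filter⁺ isSetPartition? (sublists-unique (subsets-unique n))

blocks : Word n → List (Subset n)
blocks π = map fromElements (runs (toList π))

blocks-isSetPartition : ∀ {π : Word n} → Uniqueᵛ.Unique π → IsSetPartition (blocks π)
blocks-isSetPartition {π = π} π! = fromElements-isSetPartition (runs-nonempty w)
  (subst Unique (sym (concat-runs w)) (toList-unique π!))
  (λ i → subst (i ∈_) (sym (concat-runs w)) (permutation-covers π π! i))
  where w = toList π

blocks-injective : ∀ {π ρ : Word n} → Avoids21-3 (toList π) → Avoids21-3 (toList ρ) →
                   blocks π ⊆ blocks ρ → blocks ρ ⊆ blocks π → π ≡ ρ
blocks-injective {π = π} {ρ} π-av ρ-av π⊆ρ ρ⊆π = toList-inj π ρ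
  (trans (sym (concat-runs (toList π)))
    (trans (cong concat runs≡) (concat-runs (toList ρ))))
  where
  runs⊆ : ∀ w w′ → map fromElements (runs w) ⊆ map fromElements (runs w′) → runs w ⊆ runs w′
  runs⊆ w w′ ⊆′ r∈
    with s , s∈ , eq ← ∈-map⁻ fromElements (⊆′ (∈-map⁺ fromElements r∈)) =
    subst (_∈ runs w′) (trans (sym (elements-fromElements (All.lookup (runs-ascending w′) s∈)))
      (trans (cong elements (sym eq)) (elements-fromElements (All.lookup (runs-ascending w) r∈)))) s∈
  runs≡ : runs (toList π) ≡ runs (toList ρ)
  runs≡ = sorted-unique (λ {r} {s} → ≻-asym {x = r} {s}) (runs-descending π-av) (runs-descending ρ-av)
    (runs⊆ (toList π) (toList ρ) π⊆ρ) (runs⊆ (toList ρ) (toList π) ρ⊆π)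

blocks-surjective : ∀ {F : List (Subset n)} → IsSetPartition F →
                    ∃[ π ] Uniqueᵛ.Unique π × Avoids21-3 (toList π) × blocks π ↭ F
blocks-surjective {F = F} F-part
  with G , G↭F , G↘ ← sort-comparable (λ {B} {C} {D} →
         ≻-trans {i = elements B} {elements C} {elements D}) (elements-≻-comparable F-part)
  with G-part@(G-ne , _) ← setPartition-resp-↭ (↭-sym G↭F) F-part
  with w! , w-all ← elements-unique-cover G-part
  with av , runs≡ ← descending-concat {rs = map elements G}
         (All.map⁺ (All.map (map₂ ∈-elements⁺) G-ne))
         (All.map⁺ (All.tabulate λ {B} _ → elements-ascending B))
         (AllPairs.map⁺ G↘)
  with π , refl′ ← toList-surjective _ (covering-length w! w-all) =
  π , toList-unique⁻ (subst Unique (sym refl′) w!) , subst Avoids21-3 (sym refl′) av ,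
  subst (_↭ F) (sym (trans (cong (map fromElements ∘ runs) refl′)
    (trans (cong (map fromElements) runs≡) (map-fromElements-elements G)))) G↭F

module _ {n : ℕ} where
  open DecMembership (Vec.≡-dec {n = n} Bool._≟_) using (_∈?_)

  canonical : List (Subset n) → List (Subset n)
  canonical F = filter (_∈? F) (subsets n)

  ∈-canonical⁺ : ∀ {F} → F ⊆ canonical F
  ∈-canonical⁺ {F} = ∈-filter⁺ (_∈? F) (∈-subsets _)

  ∈-canonical⁻ : ∀ {F} → canonical F ⊆ F
  ∈-canonical⁻ {F} B∈ = proj₂ (∈-filter⁻ (_∈? F) {xs = subsets n} B∈)

  canonical∈setPartitions : ∀ {F} → IsSetPartition F → canonical F ∈ setPartitions n
  canonical∈setPartitions {F} F-part =
    ∈-filter⁺ isSetPartition? (filter∈sublists (_∈? F) (subsets n))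
      (setPartition-resp-↭ (unique∧set⇒↭ (setPartition-unique F-part)
        (Unique.filter⁺ (_∈? F) (subsets-unique n)) ∈-canonical⁺ ∈-canonical⁻) F-part)

  canonical-↭ : ∀ {F G} → F ↭ G → G ∈ sublists (subsets n) → canonical F ≡ G
  canonical-↭ {F} F↭G G∈ = ∈-sublists-ext (subsets-unique n)
    (filter∈sublists (_∈? F) (subsets n)) G∈
    (∈-resp-↭ F↭G ∘ ∈-canonical⁻) (∈-canonical⁺ ∘ ∈-resp-↭ (↭-sym F↭G))

theorem5p1 : (n : ℕ) → n ≥ 1 → length (avoiders n 23∶2→1) ≡ bell n
theorem5p1 n _ = bijection⇒length≡ (canonical ∘ blocks) (avoiders-unique n) (setPartitions-unique n)
  into injective onto
  where
  into : ∀ {π} → π ∈ avoiders n 23∶2→1 → canonical (blocks π) ∈ setPartitions n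
  into {π} π∈ = canonical∈setPartitions (blocks-isSetPartition {π = π} (proj₁ (∈-avoiders⁻ π∈)))
  injective : ∀ {π ρ} → π ∈ avoiders n 23∶2→1 → ρ ∈ avoiders n 23∶2→1 →
              canonical (blocks π) ≡ canonical (blocks ρ) → π ≡ ρ
  injective π∈ ρ∈ eq = blocks-injective (proj₂ (∈-avoiders⁻ π∈)) (proj₂ (∈-avoiders⁻ ρ∈))
    (λ B∈ → ∈-canonical⁻ (subst (_ ∈_) eq (∈-canonical⁺ B∈)))
    (λ B∈ → ∈-canonical⁻ (subst (_ ∈_) (sym eq) (∈-canonical⁺ B∈)))
  onto : ∀ {F} → F ∈ setPartitions n → ∃[ π ] π ∈ avoiders n 23∶2→1 × canonical (blocks π) ≡ F
  onto F∈
    with F∈′ , F-part ← ∈-filter⁻ isSetPartition? {xs = sublists (subsets n)} F∈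
    with π , π! , av , blocks↭F ← blocks-surjective F-part =
    π , ∈-avoiders⁺ π! av , canonical-↭ blocks↭F F∈′
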